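{- Let $n \ge 1$, let $B_0(n)$ be the set of binary words of length $n$ whose first bit is $0$, and let $\alpha_0,\alpha_1,\ldots,\alpha_{N-1}$ with $N = 2^{n-1}$ be the words of $B_0(n)$ in lexicographic order. For any integer $k \ge 0$, the sequence $\alpha_0^k\alpha_1^k\cdots\alpha_{N-1}^k$ (the concatenation of $k$ copies of each word, in lexicographic order) is a multiversal cycle of the unlabeled binary words $U(n)$ with multiplicity $r = kn$.
   Context: Let $B(n)$ be the set of binary words of length $n$, and for $w\in B(n)$ let $\overline{w}$ be its bitwise complement. Unlabeled binary words of length $n$ are binary words with $w$ and $\overline{w}$ regarded as equivalent; $U(n)$ denotes any set containing exactly one representative of each of the $2^{n-1}$ pairs $\{w,\overline{w}\}$. A multiversal cycle of $U(n)$ of multiplicity (repetition) $r$ is a binary sequence $S = s_0 s_1\cdots s_{|S|-1}$ (indices modulo $|S|$) with $|S| = r\cdot 2^{n-1}$ such that for every $0 \le j < r$ the set of words $$\{\, s_{j+tr}\, s_{j+tr+1}\cdots s_{j+tr+n-1} : 0 \le t < 2^{n-1} \,\}$$ contains exactly one word from each pair $\{w,\overline{w}\}$, $w\in B(n)$. (The set represented may be a different choice of representatives for different $j$.) -}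

module Defs where

open import Data.Bool.Base as Bool using (Bool; true; false; not)
open import Data.Fin.Base as Fin using (Fin; zero; suc; toℕ; combine; remQuot)
open import Data.Fin.Properties
  using (<-asym; combine-monoˡ-<; combine-surjective; remQuot-combine; toℕ-combine)
open import Data.List.Base using (List; length; lookup; replicate; concat; tabulate)
open import Data.Nat.Base as ℕ using (ℕ; zero; suc; _+_; _*_; _∸_; _^_; _<_; NonZero; >-nonZero)
open import Data.Nat.DivMod using (_mod_)
open import Data.Nat.Properties using (m*n≢0; m^n≢0; m<n⇒0<n; +-cancelˡ-<)
open import Data.Product using (∃; ∃!; _×_; _,_; proj₁; proj₂)
open import Data.Sum.Base using (_⊎_)
open import Data.Vec.Base as Vec using (Vec; []; _∷_; toList)
open import Data.Vec.Relation.Binary.Lex.Strict using (Lex-<; this; next)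
open import Level using (0ℓ)
open import Relation.Binary.PropositionalEquality
  using (_≡_; refl; sym; cong; subst; subst₂)
open import Relation.Nullary.Negation using (contradiction)
open import Relation.Unary using (Pred)

-- The bit 0 is false and the bit 1 is true.
Word : ℕ → Set
Word n = Vec Bool n

complement : ∀ {n} → Word n → Word n
complement = Vec.map not

infix 4 _<ₗₑₓ_
_<ₗₑₓ_ : ∀ {n} → Word n → Word n → Set
_<ₗₑₓ_ = Lex-< _≡_ Bool._<_

data B₀ : ∀ {n} → Word n → Set where
  0∷_ : ∀ {n} (w : Word n) → B₀ (false ∷ w)

record IsLexEnumerationOfB₀ {n N : ℕ} (α : Fin N → Word n) : Set where
  field
    sound      : ∀ i → B₀ (α i)
    complete   : ∀ w → B₀ w → ∃ λ i → α i ≡ w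
    increasing : ∀ {i j} → i Fin.< j → α i <ₗₑₓ α j

ExactlyOneOfEachPair : ∀ {n} → Pred (Word n) 0ℓ → Set
ExactlyOneOfEachPair P = ∀ w → ∃! _≡_ λ v → (v ≡ w ⊎ v ≡ complement w) × P v

-- The word s_i s_{i+1} ⋯ s_{i+n-1}, with indices modulo the length of S.
window : ∀ n (S : List Bool) .{{_ : NonZero (length S)}} → ℕ → Word n
window n S i = Vec.tabulate λ p → lookup S ((i + toℕ p) mod length S)

length-nonZero : ∀ {n r j} (S : List Bool) →
                 length S ≡ r * 2 ^ (n ∸ 1) → j < r → NonZero (length S)
length-nonZero {n} {r} S eq j<r =
  subst NonZero (sym eq)
    (m*n≢0 r (2 ^ (n ∸ 1)) {{>-nonZero (m<n⇒0<n j<r)}} {{m^n≢0 2 (n ∸ 1)}})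

record IsMultiversalCycle (n r : ℕ) (S : List Bool) : Set where
  field
    length≡ : length S ≡ r * 2 ^ (n ∸ 1)

  -- An empty S has no indices modulo its length, but then r = 0 and there is
  -- no j to consider.
  windowsFrom : ∀ j → j < r → Pred (Word n) 0ℓ
  windowsFrom j j<r w =
    ∃ λ t → t < 2 ^ (n ∸ 1) × window n S {{length-nonZero {n} S length≡ j<r}} (j + t * r) ≡ w

  field
    representatives : ∀ j (j<r : j < r) → ExactlyOneOfEachPair (windowsFrom j j<r)

infixr 8 _^ʷ_
_^ʷ_ : ∀ {n} → Word n → ℕ → List Bool
w ^ʷ k = concat (replicate k (toList w))

concatPowers : ∀ {n N} → (Fin N → Word n) → ℕ → List Bool
concatPowers α k = concat (tabulate λ i → α i ^ʷ k)

-- Lexicographic enumerations of B₀ exist: write indices in base 2, most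
-- significant digit first.
bit : Fin 2 → Bool
bit zero       = false
bit (suc zero) = true

digits : ∀ m → Fin (2 ^ m) → Word m
digits zero    _ = []
digits (suc m) i = bit (proj₁ qs) ∷ digits m (proj₂ qs)
  where qs = remQuot {2} (2 ^ m) i

digits-combine : ∀ m q s → digits (suc m) (combine {2} q s) ≡ bit q ∷ digits m s
digits-combine m q s =
  cong (λ qs → bit (proj₁ qs) ∷ digits m (proj₂ qs)) (remQuot-combine {2} {2 ^ m} q s)

digits-complete : ∀ m (w : Word m) → ∃ λ i → digits m i ≡ w
digits-complete zero    []      = zero , refl
digits-complete (suc m) (b ∷ w) with s , refl ← digits-complete m w with b
... | false = combine {2} zero s , digits-combine m zero s
... | true  = combine {2} (suc zero) s , digits-combine m (suc zero) s

combine-cancelˡ-< : ∀ {m n} (q : Fin m) {s s′ : Fin n} →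
                    combine q s Fin.< combine q s′ → s Fin.< s′
combine-cancelˡ-< {n = n} q {s} {s′} lt = +-cancelˡ-< (n * toℕ q) _ _
  (subst₂ _<_ (toℕ-combine q s) (toℕ-combine q s′) lt)

digits-increasing : ∀ m {i j} → i Fin.< j → digits m i <ₗₑₓ digits m j
digits-increasing zero    {zero} {zero} ()
digits-increasing (suc m) {i} {j} i<j
  with q , s , refl ← combine-surjective {2} {2 ^ m} i
     | q′ , s′ , refl ← combine-surjective {2} {2 ^ m} j
  rewrite digits-combine m q s | digits-combine m q′ s′
  with q | q′
... | zero     | suc zero = this Bool.f<t refl
... | suc zero | zero     =
  contradiction i<j (<-asym (combine-monoˡ-< {m = 2} {i = zero} {j = suc zero} s′ s (ℕ.s≤s ℕ.z≤n)))
... | zero     | zero     = next refl (digits-increasing m (combine-cancelˡ-< {2} zero i<j))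
... | suc zero | suc zero = next refl (digits-increasing m (combine-cancelˡ-< {2} (suc zero) i<j))

lexEnumeration : ∀ m → IsLexEnumerationOfB₀ {suc m} {2 ^ m} (λ i → false ∷ digits m i)
lexEnumeration m = record
  { sound      = λ i → 0∷ digits m i
  ; complete   = λ { _ (0∷ w) → proj₁ (digits-complete m w)
                              , cong (false ∷_) (proj₂ (digits-complete m w)) }
  ; increasing = λ i<j → next refl (digits-increasing m i<j)
  }

{-# OPTIONS --safe #-}

-- Write j = q n + p with p < n.  For p = 0 the windows are the words α_t
-- themselves.  Otherwise the window at j + t k n is v u, where α_t = x v with
-- |x| = p, and u is the p-prefix of the next block, which is α_t when
-- q + 1 < k and α_{t+1} (cyclically) when q + 1 = k.  So the first bit of u,
-- at position n - p, is 0, and every word with a 0 there is obtained: for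
-- q + 1 < k it is a rotation of a word of B₀, and for q + 1 = k, since α_t is
-- the binary expansion of t, it suffices to find t with low digits v such that
-- t + 1 has high digits u.  Hence the windows for fixed j are exactly the words
-- with a 0 at a fixed position.
module Submission where

open import Defs
open import Data.Bool.Base as Bool using (Bool; true; false; not; _∧_; _xor_)
open import Data.Fin.Base as Fin
  using (Fin; zero; suc; toℕ; fromℕ<; combine; splitAt; _↑ˡ_; _↑ʳ_)
open import Data.Fin.Properties
  using (toℕ<n; toℕ-fromℕ<; toℕ-cast; toℕ-↑ˡ; toℕ-↑ʳ; toℕ-combine; combine-surjective; join-splitAt)
open import Data.List.Base as List using (List; length)
open import Data.Nat.Base
  using (ℕ; zero; suc; _+_; _*_; _∸_; _^_; _≤_; _<_; _≥_; z≤n; s≤s; s<s; NonZero)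
open import Data.Nat.DivMod using (_mod_; _%_; [m+kn]%n≡m%n; m<n⇒m%n≡m; m%n<n)
open import Data.Nat.Properties
open import Data.Nat.Tactic.RingSolver using (solve-∀)
open import Data.Product using (∃; ∃₂; _×_; _,_)
open import Data.Sum.Base using (inj₁; inj₂)
open import Data.Vec.Base as Vec using (Vec; []; _∷_; _++_; toList; lookup; cast)
open import Data.Vec.Properties
  using (cast-is-id; lookup-cast; lookup-map; lookup-++ˡ; lookup-++ʳ; lookup-concat; lookup-replicate;
         lookup∘tabulate; tabulate∘lookup; tabulate-cong; toList-++; length-toList)
open import Data.Vec.Relation.Binary.Lex.Strict using (base; this; next)
open import Function.Base using (_∘_)
open import Level using (0ℓ)
open import Relation.Binary.PropositionalEquality
  using (_≡_; refl; sym; trans; cong; cong₂; subst; module ≡-Reasoning)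
open import Relation.Nullary.Decidable using (yes; no)
open import Relation.Unary using (Pred)

-- Binary expansions

bitVal : Bool → ℕ
bitVal false = 0
bitVal true  = 1

val : ∀ {n} → Word n → ℕ
val []                = 0
val (_∷_ {n = m} b w) = bitVal b * 2 ^ m + val w

val-< : ∀ {n} (w : Word n) → val w < 2 ^ n
val-< []          = s≤s z≤n
val-< (false ∷ w) = <-≤-trans (val-< w) (m≤m+n _ _)
val-< (_∷_ {n = m} true w)
  rewrite +-identityʳ (2 ^ m) = +-monoʳ-< (2 ^ m) (val-< w)

val-B₀ : ∀ {n} {w : Word n} → B₀ w → val w < 2 ^ (n ∸ 1)
val-B₀ (0∷ w) = val-< w

val-mono-< : ∀ {n} {v w : Word n} → v <ₗₑₓ w → val v < val w
val-mono-< (base ())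
val-mono-< {w = _ ∷ w} (this {m = m} {xs = v} Bool.f<t _) =
  <-≤-trans (val-< v) (≤-trans (≤-reflexive (sym (+-identityʳ (2 ^ m)))) (m≤m+n _ (val w)))
val-mono-< (next {x = b} {m = m} refl v<w) = +-monoʳ-< (bitVal b * 2 ^ m) (val-mono-< v<w)

val-++ : ∀ {m n} (v : Word m) (w : Word n) → val (v ++ w) ≡ val v * 2 ^ n + val w
val-++ []                        w = refl
val-++ {suc m} {n} (b ∷ v) w
  rewrite val-++ v w | ^-distribˡ-+-* 2 m n = lemma (bitVal b) (2 ^ m) (2 ^ n) (val v) (val w)
  where
  lemma : ∀ b m n x y → b * (m * n) + (x * n + y) ≡ (b * m + x) * n + y
  lemma = solve-∀

val-cast : ∀ {m n} (eq : m ≡ n) (w : Word m) → val (cast eq w) ≡ val w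
val-cast refl w = cong val (cast-is-id refl w)

half-adder : ∀ a b → bitVal a + bitVal b ≡ bitVal (a xor b) + 2 * bitVal (a ∧ b)
half-adder false false = refl
half-adder false true  = refl
half-adder true  false = refl
half-adder true  true  = refl

-- Written as an addition, which avoids truncated subtraction: `a xor b` is the digit of the
-- difference and `not a ∧ b` the borrow.
half-subtractor : ∀ a b → bitVal (a xor b) + bitVal b ≡ bitVal a + 2 * bitVal (not a ∧ b)
half-subtractor false false = refl
half-subtractor false true  = refl
half-subtractor true  false = refl
half-subtractor true  true  = refl

private
  -- The induction step shared by addition and subtraction: the lower digits emit a carry `c` of
  -- weight `m`, which turns the leading digit `a` into `b` and emits a carry `d` of weight `2 * m`.
  propagate : ∀ a b c d x y z m → x + z ≡ y + c * m → a + c ≡ b + 2 * d →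
              (a * m + x) + z ≡ (b * m + y) + d * (2 * m)
  propagate a b c d x y z m eq₁ eq₂ = begin
    (a * m + x) + z            ≡⟨ +-assoc (a * m) x z ⟩
    a * m + (x + z)            ≡⟨ cong (a * m +_) eq₁ ⟩
    a * m + (y + c * m)        ≡⟨ lemma₁ a m y c ⟩
    (a + c) * m + y            ≡⟨ cong (λ s → s * m + y) eq₂ ⟩
    (b + 2 * d) * m + y        ≡⟨ lemma₂ b d m y ⟩
    (b * m + y) + d * (2 * m)  ∎
    where
    open ≡-Reasoning
    lemma₁ : ∀ a m y c → a * m + (y + c * m) ≡ (a + c) * m + y
    lemma₁ = solve-∀
    lemma₂ : ∀ b d m y → (b + 2 * d) * m + y ≡ (b * m + y) + d * (2 * m)
    lemma₂ = solve-∀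

-- Ripple-carry addition. The most significant digit comes first, so the recursive call on the tail
-- supplies the carry into the head.
add-carry : ∀ {n} (v : Word n) c →
            ∃₂ λ (y : Word n) c′ → val v + bitVal c ≡ val y + bitVal c′ * 2 ^ n
add-carry []      c = [] , c , sym (*-identityʳ (bitVal c))
add-carry {suc m} (b ∷ v) c with y , d , eq ← add-carry v c =
  (b xor d) ∷ y , b ∧ d , propagate (bitVal b) (bitVal (b xor d)) (bitVal d) (bitVal (b ∧ d))
    (val v) (val y) (bitVal c) (2 ^ m) eq (half-adder b d)

-- The same recursion run backwards: `x` is `u` minus the incoming bit, modulo `2 ^ n`, and `c′` is
-- the final borrow.
subtract-carry : ∀ {n} (u : Word n) c →
                 ∃₂ λ (x : Word n) c′ → val x + bitVal c ≡ val u + bitVal c′ * 2 ^ n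
subtract-carry []      c = [] , c , sym (*-identityʳ (bitVal c))
subtract-carry {suc m} (b ∷ u) c with x , d , eq ← subtract-carry u c =
  (b xor d) ∷ x , not b ∧ d , propagate (bitVal (b xor d)) (bitVal b) (bitVal d) (bitVal (not b ∧ d))
    (val x) (val u) (bitVal c) (2 ^ m) eq (half-subtractor b d)

-- A number with given low digits whose successor, modulo 2 ^ (p + l), has
-- given high digits.
successor-with-prefix : ∀ {p l} (u : Word p) (v : Word l) →
  ∃ λ (x : Word p) → ∃₂ λ (y : Word l) c →
  suc (val (x ++ v)) ≡ val (u ++ y) + c * 2 ^ (p + l)
successor-with-prefix {p} {l} u v
  with y , d , eq₁ ← add-carry v true
  with x , e , eq₂ ← subtract-carry u d
  = x , y , bitVal e , (begin
    suc (val (x ++ v))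
      ≡⟨ cong suc (val-++ x v) ⟩
    suc (val x * 2 ^ l + val v)
      ≡⟨ lemma₁ (val x * 2 ^ l) (val v) ⟩
    val x * 2 ^ l + (val v + 1)
      ≡⟨ cong (val x * 2 ^ l +_) eq₁ ⟩
    val x * 2 ^ l + (val y + bitVal d * 2 ^ l)
      ≡⟨ lemma₂ (val x) (2 ^ l) (val y) (bitVal d) ⟩
    (val x + bitVal d) * 2 ^ l + val y
      ≡⟨ cong (λ s → s * 2 ^ l + val y) eq₂ ⟩
    (val u + bitVal e * 2 ^ p) * 2 ^ l + val y
      ≡⟨ lemma₃ (val u) (bitVal e) (2 ^ p) (2 ^ l) (val y) ⟩
    (val u * 2 ^ l + val y) + bitVal e * (2 ^ p * 2 ^ l)
      ≡⟨ cong₂ (λ s r → s + bitVal e * r) (val-++ u y) (^-distribˡ-+-* 2 p l) ⟨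
    val (u ++ y) + bitVal e * 2 ^ (p + l) ∎)
  where
  open ≡-Reasoning
  lemma₁ : ∀ a b → suc (a + b) ≡ a + (b + 1)
  lemma₁ = solve-∀
  lemma₂ : ∀ x m y d → x * m + (y + d * m) ≡ (x + d) * m + y
  lemma₂ = solve-∀
  lemma₃ : ∀ u e p l y → (u + e * p) * l + y ≡ (u * l + y) + e * (p * l)
  lemma₃ = solve-∀

-- There are as many values as places in the range, so none can be skipped. All values after the
-- first exceed `a`, and induction fixes them.
increasing-in-range : ∀ m (f : Fin m → ℕ) a → (∀ {i j} → i Fin.< j → f i < f j) →
                      (∀ i → a ≤ f i) → (∀ i → f i < a + m) → ∀ i → f i ≡ a + toℕ i
increasing-in-range (suc m) f a inc lo hi = values
  where
  tail-values : ∀ i → f (suc i) ≡ suc a + toℕ i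
  tail-values = increasing-in-range m (f ∘ suc) (suc a) (λ i<j → inc (s<s i<j))
    (λ i → ≤-<-trans (lo zero) (inc (s≤s z≤n)))
    (λ i → subst (f (suc i) <_) (+-suc a m) (hi (suc i)))

  -- The first value is bounded by its successor, already known to be `suc a`, or, if there is none,
  -- by the upper end `a + 1` of the range.
  head-value : ∀ k → (∀ (i : Fin k) → f zero < suc a + toℕ i) → f zero < a + suc k → f zero ≤ a
  head-value zero    _  f₀<a+1 = m<1+n⇒m≤n (subst (f zero <_) (+-comm a 1) f₀<a+1)
  head-value (suc k) f₀<f₁ _   = m<1+n⇒m≤n (subst (f zero <_) (cong suc (+-identityʳ a)) (f₀<f₁ zero))

  values : ∀ i → f i ≡ a + toℕ i
  values zero    = trans (≤-antisym (head-value m (λ i → subst (f zero <_) (tail-values i) (inc (s≤s z≤n)))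
                                                  (hi zero))
                                    (lo zero))
                         (sym (+-identityʳ a))
  values (suc i) = trans (tail-values i) (sym (+-suc a (toℕ i)))

-- Lexicographic order enters the proof here: it turns the index of a word into the number that the
-- word expands, so that passing to the next word is adding 1.
val-enumeration : ∀ {n} {α : Fin (2 ^ (n ∸ 1)) → Word n} → IsLexEnumerationOfB₀ α →
                  ∀ i → val (α i) ≡ toℕ i
val-enumeration enum = increasing-in-range _ _ 0 (val-mono-< ∘ increasing) (λ _ → z≤n) (val-B₀ ∘ sound)
  where open IsLexEnumerationOfB₀ enum

-- Words split with the lengths p and l exchanged

↑-elim : ∀ {l p} (P : Pred (Fin (l + p)) 0ℓ) →
         (∀ i → P (i ↑ˡ p)) → (∀ j → P (l ↑ʳ j)) → ∀ i → P i
↑-elim {l} {p} P left right i with splitAt l i | join-splitAt l p i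
... | inj₁ i′ | refl = left i′
... | inj₂ j  | refl = right j

-- A window reads `v ++ u`, of length `l + p`, whereas the word it starts in is `x ++ v`, of length
-- `p + l`. The cast lets both have the same type.
join′ : ∀ {p l} → Word p → Word l → Word (l + p)
join′ {p} {l} x v = cast (+-comm p l) (x ++ v)

join′-surjective : ∀ {p l} (w : Word (l + p)) → ∃₂ λ (x : Word p) (v : Word l) → w ≡ join′ x v
join′-surjective {p} {l} w = split (+-comm p l) w
  where
  split : ∀ {n} (eq : p + l ≡ n) (w : Word n) → ∃₂ λ (x : Word p) (v : Word l) → w ≡ cast eq (x ++ v)
  split refl w with x , v , refl ← Vec.splitAt p w = x , v , sym (cast-is-id refl (x ++ v))

B₀-cast⁺ : ∀ {m n} (eq : suc m ≡ n) (w : Word m) → B₀ (cast eq (false ∷ w))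
B₀-cast⁺ refl w = 0∷ _

B₀-cast⁻ : ∀ {m n} (eq : suc m ≡ n) b (w : Word m) → B₀ (cast eq (b ∷ w)) → b ≡ false
B₀-cast⁻ refl b w (0∷ _) = refl

-- Complementing flips bit `i`, so exactly one word of each pair has a 0 there.
exactlyOne-by-bit : ∀ {n} {P : Pred (Word n) 0ℓ} (i : Fin n) →
                    (∀ w → P w → lookup w i ≡ false) → (∀ w → lookup w i ≡ false → P w) →
                    ExactlyOneOfEachPair P
exactlyOne-by-bit {P = P} i sound complete w with lookup w i in eq
... | false = w , (inj₁ refl , complete w eq) , unique
  where
  unique : ∀ {v} → _ → w ≡ v
  unique (inj₁ refl , _)  = refl
  unique (inj₂ refl , Pv)
    with () ← trans (sym (sound _ Pv)) (trans (lookup-map i not w) (cong not eq))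
... | true = complement w
           , (inj₂ refl , complete _ (trans (lookup-map i not w) (cong not eq)))
           , unique
  where
  unique : ∀ {v} → _ → complement w ≡ v
  unique (inj₂ refl , _)  = refl
  unique (inj₁ refl , Pv) with () ← trans (sym (sound _ Pv)) eq

-- The sequence as a vector

-- The nested length makes `combine t (combine q x)` the position of bit `x` in copy `q` of `α t`.
powers : ∀ {n N} → (Fin N → Word n) → ∀ k → Vec Bool (N * (k * n))
powers α k = Vec.concat (Vec.tabulate λ i → Vec.concat (Vec.replicate k (α i)))

toList-powers : ∀ {n N} (α : Fin N → Word n) k → toList (powers α k) ≡ concatPowers α k
toList-powers {n} α k = tabulated α
  where
  replicated : ∀ k (w : Word n) → toList (Vec.concat (Vec.replicate k w)) ≡ w ^ʷ k
  replicated zero    w = refl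
  replicated (suc k) w = trans (toList-++ w _) (cong (toList w List.++_) (replicated k w))

  tabulated : ∀ {N} (α : Fin N → Word n) → toList (powers α k) ≡ concatPowers α k
  tabulated {zero}  α = refl
  tabulated {suc N} α = trans (toList-++ (Vec.concat (Vec.replicate k (α zero))) _)
                              (cong₂ List._++_ (replicated k (α zero)) (tabulated (α ∘ suc)))

lookup-powers : ∀ {n N} (α : Fin N → Word n) k t q x →
                lookup (powers α k) (combine t (combine {k} q x)) ≡ lookup (α t) x
lookup-powers α k t q x = begin
  lookup (powers α k) (combine t (combine q x))
    ≡⟨ lookup-concat (Vec.tabulate λ i → Vec.concat (Vec.replicate k (α i))) t (combine q x) ⟩
  lookup (lookup (Vec.tabulate λ i → Vec.concat (Vec.replicate k (α i))) t) (combine q x)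
    ≡⟨ cong (λ v → lookup v (combine q x)) (lookup∘tabulate (λ i → Vec.concat (Vec.replicate k (α i))) t) ⟩
  lookup (Vec.concat (Vec.replicate k (α t))) (combine q x)
    ≡⟨ lookup-concat (Vec.replicate k (α t)) q x ⟩
  lookup (lookup (Vec.replicate k (α t)) q) x
    ≡⟨ cong (λ v → lookup v x) (lookup-replicate q (α t)) ⟩
  lookup (α t) x ∎
  where open ≡-Reasoning

lookup-toList : ∀ {A : Set} {m} (v : Vec A m) (i : Fin (length (toList v))) (j : Fin m) →
                toℕ i ≡ toℕ j → List.lookup (toList v) i ≡ lookup v j
lookup-toList (x ∷ v) zero    zero    _  = refl
lookup-toList (x ∷ v) (suc i) (suc j) eq = lookup-toList v i j (suc-injective eq)

toℕ-mod : ∀ {m} x L .{{_ : NonZero L}} (j : Fin m) c → L ≡ m → x ≡ toℕ j + c * m →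
          toℕ (x mod L) ≡ toℕ j
toℕ-mod x L j c refl refl = begin
  toℕ (x mod L)         ≡⟨ toℕ-fromℕ< (m%n<n x L) ⟩
  (toℕ j + c * L) % L   ≡⟨ [m+kn]%n≡m%n (toℕ j) c L ⟩
  toℕ j % L             ≡⟨ m<n⇒m%n≡m (toℕ<n j) ⟩
  toℕ j                 ∎
  where open ≡-Reasoning

-- Replaces reduction modulo the length by an explicit certificate: `c` counts the full turns that
-- separate `x` from `j`.
lookup-mod : ∀ {A : Set} {m} (v : Vec A m) .{{_ : NonZero (length (toList v))}} x (j : Fin m) c →
             x ≡ toℕ j + c * m → List.lookup (toList v) (x mod length (toList v)) ≡ lookup v j
lookup-mod v x j c eq =
  lookup-toList v _ j (toℕ-mod x (length (toList v)) j c (length-toList v) eq)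

-- The blocks are numbered consecutively by `combine t q`, and each occupies `n` bits.
toℕ-combine₃ : ∀ {N k n} (t : Fin N) (q : Fin k) (x : Fin n) →
               toℕ (combine t (combine q x)) ≡ n * toℕ (combine t q) + toℕ x
toℕ-combine₃ {k = k} {n} t q x
  rewrite toℕ-combine t (combine q x) | toℕ-combine q x | toℕ-combine t q
  = lemma k n (toℕ t) (toℕ q) (toℕ x)
  where
  lemma : ∀ k n t q x → k * n * t + (n * q + x) ≡ n * (k * t + q) + x
  lemma = solve-∀

-- Windows and consecutive blocks

cyclic-suc : ∀ {m} (i : Fin m) → ∃₂ λ (j : Fin m) c → suc (toℕ i) ≡ toℕ j + c * m
cyclic-suc {suc m} i with suc (toℕ i) <? suc m
... | yes i+1<m = fromℕ< i+1<m , 0 , sym (trans (+-identityʳ _) (toℕ-fromℕ< i+1<m))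
... | no  i+1≮m = zero , 1 , trans (≤-antisym (toℕ<n i) (≮⇒≥ i+1≮m)) (sym (+-identityʳ (suc m)))

Windows : ∀ {n N} (α : Fin N → Word n) k .{{_ : NonZero (length (toList (powers α k)))}} →
          ℕ → Pred (Word n) 0ℓ
Windows {n} {N} α k j w = ∃ λ (t : Fin N) → window n (toList (powers α k)) (j + toℕ t * (k * n)) ≡ w

-- The pair (t , q) stands for the q-th copy of α t; c counts the wrap-around
-- from the end of the sequence to its start.
module _ {N k : ℕ} where

  _FollowedBy_ : Fin N × Fin k → Fin N × Fin k → Set
  (t , q) FollowedBy (t′ , q′) =
    ∃ λ c → suc (toℕ (combine t q)) ≡ toℕ (combine t′ q′) + c * (N * k)

  next-block : ∀ t q → ∃ ((t , q) FollowedBy_)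
  next-block t q
    with b , c , eq ← cyclic-suc (combine t q)
    with t′ , q′ , refl ← combine-surjective {N} {k} b
    = (t′ , q′) , c , eq

  next-copy : ∀ t {q q′} → suc (toℕ q) ≡ toℕ q′ → (t , q) FollowedBy (t , q′)
  next-copy t {q} {q′} eq = 0 , (begin
    suc (toℕ (combine t q))       ≡⟨ cong suc (toℕ-combine t q) ⟩
    suc (k * toℕ t + toℕ q)       ≡⟨ +-suc (k * toℕ t) (toℕ q) ⟨
    k * toℕ t + suc (toℕ q)       ≡⟨ cong (k * toℕ t +_) eq ⟩
    k * toℕ t + toℕ q′            ≡⟨ toℕ-combine t q′ ⟨
    toℕ (combine t q′)            ≡⟨ +-identityʳ _ ⟨
    toℕ (combine t q′) + 0        ∎)
    where open ≡-Reasoning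

-- After the last copy of one word comes the first copy of the next: multiplying the relation
-- between word indices by the number of copies gives the one between block numbers, with the same
-- wrap-around `c`.
next-word : ∀ {N k} {t t′ : Fin N} {q : Fin (suc k)} c →
            toℕ q ≡ k → suc (toℕ t) ≡ toℕ t′ + c * N → (t , q) FollowedBy (t′ , zero)
next-word {N} {k} {t} {t′} {q} c q≡k eq = c , (begin
  suc (toℕ (combine t q))                   ≡⟨ cong suc (toℕ-combine t q) ⟩
  suc (suc k * toℕ t + toℕ q)               ≡⟨ cong (λ s → suc (suc k * toℕ t + s)) q≡k ⟩
  suc (suc k * toℕ t + k)                   ≡⟨ lemma₁ k (toℕ t) ⟩
  suc k * suc (toℕ t)                       ≡⟨ cong (suc k *_) eq ⟩
  suc k * (toℕ t′ + c * N)                  ≡⟨ lemma₂ k (toℕ t′) c N ⟩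
  (suc k * toℕ t′ + 0) + c * (N * suc k)    ≡⟨ cong (_+ c * (N * suc k)) (toℕ-combine t′ (zero {k})) ⟨
  toℕ (combine t′ (zero {k})) + c * (N * suc k)  ∎)
  where
  open ≡-Reasoning
  lemma₁ : ∀ k t → suc (suc k * t + k) ≡ suc k * suc t
  lemma₁ = solve-∀
  lemma₂ : ∀ k t c N → suc k * (t + c * N) ≡ (suc k * t + 0) + c * (N * suc k)
  lemma₂ = solve-∀

window-of-block : ∀ {n N} (α : Fin N → Word n) k .{{_ : NonZero (length (toList (powers α k)))}} t q →
                  window n (toList (powers α k)) (toℕ {k} q * n + toℕ t * (k * n)) ≡ α t
window-of-block {n} α k t q = trans (tabulate-cong bits) (tabulate∘lookup (α t))
  where
  lemma : ∀ k n t q x → q * n + t * (k * n) + x ≡ n * (k * t + q) + x + 0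
  lemma = solve-∀

  bits : ∀ x → _ ≡ lookup (α t) x
  bits x = trans
    (lookup-mod (powers α k) _ (combine t (combine q x)) 0
      (trans (lemma k n (toℕ t) (toℕ q) (toℕ x))
             (cong (_+ 0) (sym (trans (toℕ-combine₃ t q x) (cong (λ s → n * s + toℕ x) (toℕ-combine t q)))))))
    (lookup-powers α k t q x)

-- Starting `p` bits into a block, the window reads the remaining `l` bits `v` of that block and
-- then the first `p` bits `u` of the following one.
window-across-blocks :
  ∀ {l p N} (α : Fin N → Word (l + p)) k .{{_ : NonZero (length (toList (powers α k)))}}
  {t t′ q q′} {x u : Word p} {v y : Word l} →
  (t , q) FollowedBy (t′ , q′) → α t ≡ join′ x v → α t′ ≡ join′ u y →
  window (l + p) (toList (powers α k)) ((toℕ {k} q * (l + p) + p) + toℕ t * (k * (l + p))) ≡ v ++ u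
window-across-blocks {l} {p} {N} α k {t} {t′} {q} {q′} {x} {u} {v} {y} (c , next≡) αt≡ αt′≡ =
  trans (tabulate-cong (↑-elim (λ i → bit-at i ≡ lookup (v ++ u) i) left right)) (tabulate∘lookup (v ++ u))
  where
  open ≡-Reasoning
  n = l + p
  V = powers α k
  start = (toℕ q * n + p) + toℕ t * (k * n)

  bit-at : Fin n → Bool
  bit-at i = List.lookup (toList V) ((start + toℕ i) mod length (toList V))

  swap : Fin (p + l) → Fin n
  swap = Fin.cast (+-comm p l)

  arith₁ : ∀ n k p q t i → (q * n + p) + t * (k * n) + i ≡ n * (k * t + q) + (p + i) + 0
  arith₁ = solve-∀

  position₁ : ∀ i → start + toℕ (i ↑ˡ p) ≡ toℕ (combine t (combine q (swap (p ↑ʳ i)))) + 0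
  position₁ i = begin
    start + toℕ (i ↑ˡ p)                        ≡⟨ cong (start +_) (toℕ-↑ˡ i p) ⟩
    start + toℕ i                               ≡⟨ arith₁ n k p (toℕ q) (toℕ t) (toℕ i) ⟩
    n * (k * toℕ t + toℕ q) + (p + toℕ i) + 0
      ≡⟨ cong (_+ 0) (cong₂ (λ b j → n * b + j) (toℕ-combine t q)
                            (trans (toℕ-cast (+-comm p l) (p ↑ʳ i)) (toℕ-↑ʳ p i))) ⟨
    n * toℕ (combine t q) + toℕ (swap (p ↑ʳ i)) + 0
      ≡⟨ cong (_+ 0) (toℕ-combine₃ t q (swap (p ↑ʳ i))) ⟨
    toℕ (combine t (combine q (swap (p ↑ʳ i)))) + 0 ∎

  left : ∀ i → bit-at (i ↑ˡ p) ≡ lookup (v ++ u) (i ↑ˡ p)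
  left i = begin
    bit-at (i ↑ˡ p)                             ≡⟨ lookup-mod V _ _ 0 (position₁ i) ⟩
    lookup V (combine t (combine q (swap (p ↑ʳ i))))  ≡⟨ lookup-powers α k t q (swap (p ↑ʳ i)) ⟩
    lookup (α t) (swap (p ↑ʳ i))                ≡⟨ cong (λ w → lookup w (swap (p ↑ʳ i))) αt≡ ⟩
    lookup (join′ x v) (swap (p ↑ʳ i))          ≡⟨ lookup-cast (+-comm p l) (x ++ v) (p ↑ʳ i) ⟩
    lookup (x ++ v) (p ↑ʳ i)                    ≡⟨ lookup-++ʳ x v i ⟩
    lookup v i                                  ≡⟨ lookup-++ˡ v u i ⟨
    lookup (v ++ u) (i ↑ˡ p)                    ∎

  -- The `p` bits skipped and the `l` bits read complete a block, whence the `suc` on the block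
  -- number.
  arith₂ : ∀ l p k q t j →
           (q * (l + p) + p) + t * (k * (l + p)) + (l + j) ≡ (l + p) * suc (k * t + q) + j
  arith₂ = solve-∀

  arith₃ : ∀ n b c N k j → n * (b + c * (N * k)) + j ≡ n * b + j + c * (N * (k * n))
  arith₃ = solve-∀

  position₂ : ∀ j → start + toℕ (l ↑ʳ j) ≡
                    toℕ (combine t′ (combine q′ (swap (j ↑ˡ l)))) + c * (N * (k * n))
  position₂ j = begin
    start + toℕ (l ↑ʳ j)                          ≡⟨ cong (start +_) (toℕ-↑ʳ l j) ⟩
    start + (l + toℕ j)                           ≡⟨ arith₂ l p k (toℕ q) (toℕ t) (toℕ j) ⟩
    n * suc (k * toℕ t + toℕ q) + toℕ j
      ≡⟨ cong (λ b → n * suc b + toℕ j) (toℕ-combine t q) ⟨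
    n * suc (toℕ (combine t q)) + toℕ j           ≡⟨ cong (λ b → n * b + toℕ j) next≡ ⟩
    n * (toℕ (combine t′ q′) + c * (N * k)) + toℕ j
      ≡⟨ arith₃ n (toℕ (combine t′ q′)) c N k (toℕ j) ⟩
    n * toℕ (combine t′ q′) + toℕ j + c * (N * (k * n))
      ≡⟨ cong (λ i → n * toℕ (combine t′ q′) + i + c * (N * (k * n)))
              (trans (toℕ-cast (+-comm p l) (j ↑ˡ l)) (toℕ-↑ˡ j l)) ⟨
    n * toℕ (combine t′ q′) + toℕ (swap (j ↑ˡ l)) + c * (N * (k * n))
      ≡⟨ cong (_+ c * (N * (k * n))) (toℕ-combine₃ t′ q′ (swap (j ↑ˡ l))) ⟨
    toℕ (combine t′ (combine q′ (swap (j ↑ˡ l)))) + c * (N * (k * n)) ∎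

  right : ∀ j → bit-at (l ↑ʳ j) ≡ lookup (v ++ u) (l ↑ʳ j)
  right j = begin
    bit-at (l ↑ʳ j)                             ≡⟨ lookup-mod V _ _ c (position₂ j) ⟩
    lookup V (combine t′ (combine q′ (swap (j ↑ˡ l))))  ≡⟨ lookup-powers α k t′ q′ (swap (j ↑ˡ l)) ⟩
    lookup (α t′) (swap (j ↑ˡ l))               ≡⟨ cong (λ w → lookup w (swap (j ↑ˡ l))) αt′≡ ⟩
    lookup (join′ u y) (swap (j ↑ˡ l))          ≡⟨ lookup-cast (+-comm p l) (u ++ y) (j ↑ˡ l) ⟩
    lookup (u ++ y) (j ↑ˡ l)                    ≡⟨ lookup-++ˡ u y j ⟩
    lookup u j                                  ≡⟨ lookup-++ʳ v u j ⟨
    lookup (v ++ u) (l ↑ʳ j)                    ∎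

-- Which words occur

aligned-windows : ∀ {m N} {α : Fin N → Word (suc m)} → IsLexEnumerationOfB₀ α →
                  ∀ k .{{_ : NonZero (length (toList (powers α k)))}} q →
                  ExactlyOneOfEachPair (Windows α k (toℕ {k} q * suc m))
aligned-windows {α = α} enum k q = exactlyOne-by-bit zero starts-with-0 occurs
  where
  open IsLexEnumerationOfB₀ enum

  B₀-head : ∀ {m} {w : Word (suc m)} → B₀ w → lookup w zero ≡ false
  B₀-head (0∷ _) = refl

  starts-with-0 : ∀ w → Windows α k _ w → lookup w zero ≡ false
  starts-with-0 _ (t , eq) = B₀-head (subst B₀ (trans (sym (window-of-block α k t q)) eq) (sound t))

  occurs : ∀ w → lookup w zero ≡ false → Windows α k _ w
  occurs (false ∷ w) refl with t , αt≡ ← complete (false ∷ w) (0∷ w) =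
    t , trans (window-of-block α k t q) αt≡

-- With offset `suc p` the part taken from the next block is nonempty. Its first bit, at position
-- `l ↑ʳ zero` of the window, is the leading 0 of a word of `B₀`.
unaligned-windows : ∀ l p {α : Fin (2 ^ (l + suc p ∸ 1)) → Word (l + suc p)} → IsLexEnumerationOfB₀ α →
                    ∀ k .{{_ : NonZero (length (toList (powers α k)))}} q →
                    ExactlyOneOfEachPair (Windows α k (toℕ {k} q * (l + suc p) + suc p))
unaligned-windows l p {α} enum k q = exactlyOne-by-bit (l ↑ʳ zero) has-0 occurs
  where
  open IsLexEnumerationOfB₀ enum
  n = l + suc p
  P = Windows α k (toℕ q * n + suc p)

  has-0 : ∀ w → P w → lookup w (l ↑ʳ zero) ≡ false
  has-0 w (t , eq)
    with (t′ , q′) , follows ← next-block t q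
    with x , v , αt≡ ← join′-surjective {suc p} {l} (α t)
    with b ∷ u , y , αt′≡ ← join′-surjective {suc p} {l} (α t′)
    = begin
      lookup w (l ↑ʳ zero)
        ≡⟨ cong (λ w → lookup w (l ↑ʳ zero))
                (trans (sym eq) (window-across-blocks α k {x = x} {v = v} {y = y} follows αt≡ αt′≡)) ⟩
      lookup (v ++ b ∷ u) (l ↑ʳ zero)     ≡⟨ lookup-++ʳ v (b ∷ u) zero ⟩
      b                                   ≡⟨ B₀-cast⁻ (+-comm (suc p) l) b (u ++ y) (subst B₀ αt′≡ (sound t′)) ⟩
      false                               ∎
    where open ≡-Reasoning

  index : ∀ (u : Word p) (v : Word l) → ∃ λ t → α t ≡ join′ (false ∷ u) v
  index u v = complete _ (B₀-cast⁺ (+-comm (suc p) l) (u ++ v))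

  -- The next block is another copy of the same word, so the word `false ∷ u` followed by `v`
  -- provides both the suffix `v` and the prefix `false ∷ u`.
  occurs-inside : ∀ u v {q′} → suc (toℕ q) ≡ toℕ q′ → P (v ++ false ∷ u)
  occurs-inside u v q+1≡ with t , αt≡ ← index u v =
    t , window-across-blocks α k {x = false ∷ u} {y = v} (next-copy t q+1≡) αt≡ αt≡

  toℕ-index : ∀ {t} (u : Word p) (v : Word l) → α t ≡ join′ (false ∷ u) v → toℕ t ≡ val (u ++ v)
  toℕ-index {t} u v αt≡ = trans (sym (val-enumeration enum t))
    (trans (cong val αt≡) (val-cast (+-comm (suc p) l) (false ∷ u ++ v)))

  size : 2 ^ (p + l) ≡ 2 ^ (n ∸ 1)
  size = cong (λ m → 2 ^ (m ∸ 1)) (+-comm (suc p) l)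

  -- The leading 0 adds nothing to the value, so `successor-with-prefix` is applied to the other
  -- `p + l` digits. Its modulus `2 ^ (p + l)` is the number of words, so an overflow is exactly the
  -- cyclic step from the last word to the first.
  consecutive : ∀ (u : Word p) (v : Word l) → ∃ λ x → ∃₂ λ y t → ∃₂ λ t′ c →
                α t ≡ join′ (false ∷ x) v × α t′ ≡ join′ (false ∷ u) y ×
                suc (toℕ t) ≡ toℕ t′ + c * 2 ^ (n ∸ 1)
  consecutive u v
    with x , y , c , eq ← successor-with-prefix u v
    with t , αt≡ ← index x v
    with t′ , αt′≡ ← index u y
    = x , y , t , t′ , c , αt≡ , αt′≡ , (begin
      suc (toℕ t)                       ≡⟨ cong suc (toℕ-index x v αt≡) ⟩
      suc (val (x ++ v))                ≡⟨ eq ⟩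
      val (u ++ y) + c * 2 ^ (p + l)    ≡⟨ cong₂ (λ s r → s + c * r) (sym (toℕ-index u y αt′≡)) size ⟩
      toℕ t′ + c * 2 ^ (n ∸ 1)          ∎)
    where open ≡-Reasoning

  next-from-last : ∀ {k N} {t t′ : Fin N} {q : Fin k} c → suc (toℕ q) ≡ k →
                   suc (toℕ t) ≡ toℕ t′ + c * N → ∃ λ q′ → (t , q) FollowedBy (t′ , q′)
  next-from-last {suc k} {t = t} c q+1≡k eq = zero , next-word {t = t} c (suc-injective q+1≡k) eq

  occurs-at-boundary : ∀ u v → suc (toℕ q) ≡ k → P (v ++ false ∷ u)
  occurs-at-boundary u v q+1≡k
    with x , y , t , t′ , c , αt≡ , αt′≡ , eq ← consecutive u v
    with q′ , follows ← next-from-last {t = t} {q = q} c q+1≡k eq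
    = t , window-across-blocks α k {x = false ∷ x} {y = y} follows αt≡ αt′≡

  occurs : ∀ w → lookup w (l ↑ʳ zero) ≡ false → P w
  occurs w bit≡0
    with v , b ∷ u , refl ← Vec.splitAt l w
    with refl ← trans (sym (lookup-++ʳ v (b ∷ u) zero)) bit≡0
    -- Either another copy of the same word follows, or `q` is the last copy and the window runs
    -- into the next word.
    with suc (toℕ q) <? k
  ... | yes q+1<k = occurs-inside u v (sym (toℕ-fromℕ< q+1<k))
  ... | no  q+1≮k = occurs-at-boundary u v (≤-antisym (toℕ<n q) (≮⇒≥ q+1≮k))

-- Arbitrary starting positions and the theorem

windows-at-offset : ∀ {n} l p → l + p ≡ n → p < n →
                    {α : Fin (2 ^ (n ∸ 1)) → Word n} → IsLexEnumerationOfB₀ α →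
                    ∀ k .{{_ : NonZero (length (toList (powers α k)))}} q →
                    ExactlyOneOfEachPair (Windows α k (toℕ {k} q * n + p))
windows-at-offset l (suc p) refl _ enum k q = unaligned-windows l p enum k q
windows-at-offset {suc m} l zero _ _ {α} enum k q =
  subst (λ j → ExactlyOneOfEachPair (Windows α k j)) (sym (+-identityʳ _)) (aligned-windows enum k q)

windows-at : ∀ {n} {α : Fin (2 ^ (n ∸ 1)) → Word n} → IsLexEnumerationOfB₀ α →
             ∀ k .{{_ : NonZero (length (toList (powers α k)))}} {j} → j < k * n →
             ExactlyOneOfEachPair (Windows α k j)
windows-at {n} {α} enum k {j} j<kn
  -- Division of `j` by `n` with remainder: `q` selects the copy and `p` the offset inside it.
  with q , p , eq ← combine-surjective {k} {n} (fromℕ< j<kn)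
  = subst (λ j → ExactlyOneOfEachPair (Windows α k j)) j≡
      (windows-at-offset (n ∸ toℕ p) (toℕ p) (m∸n+n≡m (<⇒≤ (toℕ<n p))) (toℕ<n p) enum k q)
  where
  open ≡-Reasoning
  j≡ : toℕ q * n + toℕ p ≡ j
  j≡ = begin
    toℕ q * n + toℕ p    ≡⟨ cong (_+ toℕ p) (*-comm (toℕ q) n) ⟩
    n * toℕ q + toℕ p    ≡⟨ toℕ-combine q p ⟨
    toℕ (combine q p)    ≡⟨ cong toℕ eq ⟩
    toℕ (fromℕ< j<kn)    ≡⟨ toℕ-fromℕ< j<kn ⟩
    j                    ∎

exactlyOne-resp : ∀ {n} {P Q : Pred (Word n) 0ℓ} → (∀ {w} → P w → Q w) → (∀ {w} → Q w → P w) →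
                  ExactlyOneOfEachPair P → ExactlyOneOfEachPair Q
exactlyOne-resp P⇒Q Q⇒P one w with v , (v∈ , Pv) , unique ← one w =
  v , (v∈ , P⇒Q Pv) , λ { (v′∈ , Qv′) → unique (v′∈ , Q⇒P Qv′) }

theorem12 : ∀ (n : ℕ) → n ≥ 1 →
    (α : Fin (2 ^ (n ∸ 1)) → Word n) → IsLexEnumerationOfB₀ α →
    (k : ℕ) → IsMultiversalCycle n (k * n) (concatPowers α k)
theorem12 n _ α enum k = subst (IsMultiversalCycle n (k * n)) (toList-powers α k) (record
  { length≡         = length≡
  ; representatives = λ j j<r →
      exactlyOne-resp (λ { (t , eq) → toℕ t , toℕ<n t , eq })
                      -- The two window predicates differ only in whether `t` is a bounded number or
                      -- an element of `Fin`.
                      (λ { (t , t<N , eq) → fromℕ< t<N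
                         , trans (cong (λ s → window n S {{nonZero j<r}} (j + s * (k * n))) (toℕ-fromℕ< t<N)) eq })
                      (windows-at enum k {{nonZero j<r}} j<r)
  })
  where
  S = toList (powers α k)

  length≡ : length S ≡ k * n * 2 ^ (n ∸ 1)
  length≡ = trans (length-toList (powers α k)) (*-comm (2 ^ (n ∸ 1)) (k * n))

  nonZero : ∀ {j} → j < k * n → NonZero (length S)
  nonZero = length-nonZero {n} S length≡
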